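{- Let $\mathcal A$ be cocomplete, $(M,\eta)$ a pointed endofunctor, and $\lambda:M(H\times\mathrm{Id})\to(H\times\mathrm{Id})M$ a distributive law of $(M,\eta)$ over the copointed functor $(H\times\mathrm{Id},\pi_1)$, with $\lambda$-interpretation $b:MC\to C$. Then $c^{ -1}\cdot Hb:HMC\to C$ is a completely iterative algebra for $HM$.
   Context: $\mathcal A$ has binary products and coproducts; $H:\mathcal A\to\mathcal A$ is a functor with terminal coalgebra $c:C\to HC$ (an isomorphism by Lambek's lemma). A pointed endofunctor is a functor $M$ with a natural transformation $\eta:\mathrm{Id}\to M$. A distributive law of $(M,\eta)$ over the copointed functor $(D,\varepsilon)=(H\times\mathrm{Id},\pi_1)$ is a natural transformation $\lambda:MD\to DM$ with $\lambda\cdot\eta D=D\eta$ and $\varepsilon M\cdot\lambda=M\varepsilon$. Its $\lambda$-interpretation is the unique $b:MC\to C$ with $c\cdot b=Hb\cdot\pi_0\cdot\lambda_C\cdot M\langle c,\mathrm{id}_C\rangle$; $(C,b)$ then satisfies $b\cdot\eta_C=\mathrm{id}_C$. A $G$-algebra $a:GA\to A$ is a completely iterative algebra if every $e:X\to GX+A$ has a unique $e^\dagger:X\to A$ with $e^\dagger=[a,\mathrm{id}_A]\cdot(Ge^\dagger+\mathrm{id}_A)\cdot e$. -}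

module Defs where

open import Level using (Level; suc; _⊔_)
open import Data.Product using (_,_; ∃!; proj₁; proj₂)
open import Relation.Binary.Bundles using (Setoid)
open import Relation.Binary.Structures using (IsEquivalence)
import Relation.Binary.Reasoning.Setoid as SetoidReasoning

private
  variable
    o ℓ e o′ ℓ′ e′ : Level

-- Hom-collections are setoids; "equal" and "unique" for morphisms always refer to _≈_.
record Category (o ℓ e : Level) : Set (suc (o ⊔ ℓ ⊔ e)) where
  infix  4 _≈_ _⇒_
  infixr 9 _∘_
  field
    Obj       : Set o
    _⇒_       : Obj → Obj → Set ℓ
    _≈_       : ∀ {A B} → A ⇒ B → A ⇒ B → Set e
    id        : ∀ {A} → A ⇒ A
    _∘_       : ∀ {A B C} → B ⇒ C → A ⇒ B → A ⇒ C
    equiv     : ∀ {A B} → IsEquivalence (_≈_ {A} {B})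
    ∘-resp-≈  : ∀ {A B C} {f h : B ⇒ C} {g i : A ⇒ B} → f ≈ h → g ≈ i → f ∘ g ≈ h ∘ i
    assoc     : ∀ {A B C D} {f : A ⇒ B} {g : B ⇒ C} {h : C ⇒ D} → (h ∘ g) ∘ f ≈ h ∘ (g ∘ f)
    identityˡ : ∀ {A B} {f : A ⇒ B} → id ∘ f ≈ f
    identityʳ : ∀ {A B} {f : A ⇒ B} → f ∘ id ≈ f

  module Equiv {A B : Obj} = IsEquivalence (equiv {A} {B})

  hom-setoid : Obj → Obj → Setoid ℓ e
  hom-setoid A B = record { Carrier = A ⇒ B ; _≈_ = _≈_ ; isEquivalence = equiv }

  module HomReasoning {A B : Obj} = SetoidReasoning (hom-setoid A B)

  ∘-resp-≈ˡ : ∀ {A B C} {f h : B ⇒ C} {g : A ⇒ B} → f ≈ h → f ∘ g ≈ h ∘ g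
  ∘-resp-≈ˡ p = ∘-resp-≈ p Equiv.refl

  ∘-resp-≈ʳ : ∀ {A B C} {f : B ⇒ C} {g i : A ⇒ B} → g ≈ i → f ∘ g ≈ f ∘ i
  ∘-resp-≈ʳ p = ∘-resp-≈ Equiv.refl p

record Functor (𝒜 : Category o ℓ e) (ℬ : Category o′ ℓ′ e′) : Set (o ⊔ ℓ ⊔ e ⊔ o′ ⊔ ℓ′ ⊔ e′) where
  private
    module A = Category 𝒜
    module B = Category ℬ
  field
    F₀           : A.Obj → B.Obj
    F₁           : ∀ {X Y} → X A.⇒ Y → F₀ X B.⇒ F₀ Y
    F-resp-≈     : ∀ {X Y} {f g : X A.⇒ Y} → f A.≈ g → F₁ f B.≈ F₁ g
    identity     : ∀ {X} → F₁ (A.id {X}) B.≈ B.id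
    homomorphism : ∀ {X Y Z} {f : X A.⇒ Y} {g : Y A.⇒ Z} → F₁ (g A.∘ f) B.≈ F₁ g B.∘ F₁ f

Endofunctor : Category o ℓ e → Set (o ⊔ ℓ ⊔ e)
Endofunctor 𝒜 = Functor 𝒜 𝒜

module _ {𝒜 : Category o ℓ e} where
  open Category 𝒜

  idF : Endofunctor 𝒜
  idF = record
    { F₀ = λ X → X ; F₁ = λ f → f ; F-resp-≈ = λ p → p
    ; identity = Equiv.refl ; homomorphism = Equiv.refl }

  infixr 9 _∘F_
  _∘F_ : Endofunctor 𝒜 → Endofunctor 𝒜 → Endofunctor 𝒜
  G ∘F F = record
    { F₀           = λ X → G.F₀ (F.F₀ X)
    ; F₁           = λ f → G.F₁ (F.F₁ f)
    ; F-resp-≈     = λ p → G.F-resp-≈ (F.F-resp-≈ p)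
    ; identity     = Equiv.trans (G.F-resp-≈ F.identity) G.identity
    ; homomorphism = Equiv.trans (G.F-resp-≈ F.homomorphism) G.homomorphism
    }
    where
      module G = Functor G
      module F = Functor F

record NaturalTransformation {𝒜 : Category o ℓ e} {ℬ : Category o′ ℓ′ e′}
                             (F G : Functor 𝒜 ℬ) : Set (o ⊔ ℓ ⊔ e ⊔ o′ ⊔ ℓ′ ⊔ e′) where
  private
    module A = Category 𝒜
    module F = Functor F
    module G = Functor G
  open Category ℬ
  field
    at      : ∀ X → F.F₀ X ⇒ G.F₀ X
    commute : ∀ {X Y} (f : X A.⇒ Y) → at Y ∘ F.F₁ f ≈ G.F₁ f ∘ at X

module _ (𝒜 : Category o ℓ e) where
  open Category 𝒜

  record BinaryProducts : Set (o ⊔ ℓ ⊔ e) where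
    infixr 7 _⊗_
    field
      _⊗_      : Obj → Obj → Obj
      π₀       : ∀ {A B} → A ⊗ B ⇒ A
      π₁       : ∀ {A B} → A ⊗ B ⇒ B
      ⟨_,_⟩    : ∀ {X A B} → X ⇒ A → X ⇒ B → X ⇒ A ⊗ B
      project₀ : ∀ {X A B} {f : X ⇒ A} {g : X ⇒ B} → π₀ ∘ ⟨ f , g ⟩ ≈ f
      project₁ : ∀ {X A B} {f : X ⇒ A} {g : X ⇒ B} → π₁ ∘ ⟨ f , g ⟩ ≈ g
      unique   : ∀ {X A B} {f : X ⇒ A} {g : X ⇒ B} {h : X ⇒ A ⊗ B} →
                 π₀ ∘ h ≈ f → π₁ ∘ h ≈ g → ⟨ f , g ⟩ ≈ h

    infixr 7 _⊗₁_
    _⊗₁_ : ∀ {A B A′ B′} → A ⇒ A′ → B ⇒ B′ → A ⊗ B ⇒ A′ ⊗ B′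
    f ⊗₁ g = ⟨ f ∘ π₀ , g ∘ π₁ ⟩

  record BinaryCoproducts : Set (o ⊔ ℓ ⊔ e) where
    infixr 6 _⊕_
    field
      _⊕_     : Obj → Obj → Obj
      i₀      : ∀ {A B} → A ⇒ A ⊕ B
      i₁      : ∀ {A B} → B ⇒ A ⊕ B
      [_,_]   : ∀ {X A B} → A ⇒ X → B ⇒ X → A ⊕ B ⇒ X
      inject₀ : ∀ {X A B} {f : A ⇒ X} {g : B ⇒ X} → [ f , g ] ∘ i₀ ≈ f
      inject₁ : ∀ {X A B} {f : A ⇒ X} {g : B ⇒ X} → [ f , g ] ∘ i₁ ≈ g
      unique  : ∀ {X A B} {f : A ⇒ X} {g : B ⇒ X} {h : A ⊕ B ⇒ X} →
                h ∘ i₀ ≈ f → h ∘ i₁ ≈ g → [ f , g ] ≈ h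

    infixr 6 _⊕₁_
    _⊕₁_ : ∀ {A B A′ B′} → A ⇒ A′ → B ⇒ B′ → A ⊕ B ⇒ A′ ⊕ B′
    f ⊕₁ g = [ i₀ ∘ f , i₁ ∘ g ]

module _ {𝒥 : Category o′ ℓ′ e′} {𝒜 : Category o ℓ e} (F : Functor 𝒥 𝒜) where
  private
    module J = Category 𝒥
    module F = Functor F
  open Category 𝒜

  record Cocone : Set (o ⊔ ℓ ⊔ e ⊔ o′ ⊔ ℓ′) where
    field
      apex    : Obj
      leg     : ∀ j → F.F₀ j ⇒ apex
      commute : ∀ {j k} (f : j J.⇒ k) → leg k ∘ F.F₁ f ≈ leg j

  record Colimit : Set (o ⊔ ℓ ⊔ e ⊔ o′ ⊔ ℓ′) where
    field
      cocone    : Cocone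
    open Cocone cocone
    field
      universal : ∀ (K : Cocone) →
                  ∃! _≈_ λ (u : apex ⇒ Cocone.apex K) → ∀ j → u ∘ leg j ≈ Cocone.leg K j

-- The levels o′ ℓ′ e′ say which diagram shapes count as small.
Cocomplete : ∀ {o ℓ e} (o′ ℓ′ e′ : Level) → Category o ℓ e → Set (o ⊔ ℓ ⊔ e ⊔ suc (o′ ⊔ ℓ′ ⊔ e′))
Cocomplete o′ ℓ′ e′ 𝒜 = (𝒥 : Category o′ ℓ′ e′) (F : Functor 𝒥 𝒜) → Colimit F

module _ {𝒜 : Category o ℓ e} where
  open Category 𝒜

  record Coalgebra (H : Endofunctor 𝒜) : Set (o ⊔ ℓ) where
    open Functor H
    field
      Carrier : Obj
      str     : Carrier ⇒ F₀ Carrier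

  IsCoalgebraHom : {H : Endofunctor 𝒜} (S T : Coalgebra H) →
                   Coalgebra.Carrier S ⇒ Coalgebra.Carrier T → Set e
  IsCoalgebraHom {H} S T h = T.str ∘ h ≈ Functor.F₁ H h ∘ S.str
    where
      module S = Coalgebra S
      module T = Coalgebra T

  record TerminalCoalgebra (H : Endofunctor 𝒜) : Set (o ⊔ ℓ ⊔ e) where
    field
      coalgebra : Coalgebra H
      terminal  : (S : Coalgebra H) → ∃! _≈_ (IsCoalgebraHom S coalgebra)
    open Functor H
    open Coalgebra coalgebra public renaming (Carrier to C; str to c)

    module Lambek where
      HC : Coalgebra H
      HC = record { Carrier = F₀ C ; str = F₁ c }

      c⁻¹ : F₀ C ⇒ C
      c⁻¹ = proj₁ (terminal HC)

      c⁻¹-hom : IsCoalgebraHom HC coalgebra c⁻¹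
      c⁻¹-hom = proj₁ (proj₂ (terminal HC))

      isoˡ : c⁻¹ ∘ c ≈ id
      isoˡ with h , _ , uniq ← terminal coalgebra =
        Equiv.trans (Equiv.sym (uniq step)) (uniq id-hom)
        where
          open HomReasoning
          id-hom : c ∘ id ≈ F₁ id ∘ c
          id-hom = begin
            c ∘ id     ≈⟨ identityʳ ⟩
            c          ≈⟨ identityˡ ⟨
            id ∘ c     ≈⟨ ∘-resp-≈ˡ identity ⟨
            F₁ id ∘ c  ∎
          step : c ∘ (c⁻¹ ∘ c) ≈ F₁ (c⁻¹ ∘ c) ∘ c
          step = begin
            c ∘ (c⁻¹ ∘ c)        ≈⟨ assoc ⟨
            (c ∘ c⁻¹) ∘ c        ≈⟨ ∘-resp-≈ˡ c⁻¹-hom ⟩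
            (F₁ c⁻¹ ∘ F₁ c) ∘ c  ≈⟨ ∘-resp-≈ˡ homomorphism ⟨
            F₁ (c⁻¹ ∘ c) ∘ c     ∎

      isoʳ : c ∘ c⁻¹ ≈ id
      isoʳ = begin
        c ∘ c⁻¹        ≈⟨ c⁻¹-hom ⟩
        F₁ c⁻¹ ∘ F₁ c  ≈⟨ homomorphism ⟨
        F₁ (c⁻¹ ∘ c)   ≈⟨ F-resp-≈ isoˡ ⟩
        F₁ id          ≈⟨ identity ⟩
        id             ∎
        where open HomReasoning

    open Lambek public using (c⁻¹)

module _ (𝒜 : Category o ℓ e) where

  record PointedFunctor : Set (o ⊔ ℓ ⊔ e) where
    field
      functor : Endofunctor 𝒜
      η       : NaturalTransformation idF functor

  record CopointedFunctor : Set (o ⊔ ℓ ⊔ e) where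
    field
      functor : Endofunctor 𝒜
      ε       : NaturalTransformation functor idF

module _ {𝒜 : Category o ℓ e} where
  open Category 𝒜

  record DistributiveLaw (M : PointedFunctor 𝒜) (D : CopointedFunctor 𝒜) : Set (o ⊔ ℓ ⊔ e) where
    private
      module M = PointedFunctor M
      module D = CopointedFunctor D
    open Functor M.functor renaming (F₀ to M₀; F₁ to M₁) using ()
    open Functor D.functor renaming (F₀ to D₀; F₁ to D₁) using ()
    open NaturalTransformation M.η renaming (at to η) using ()
    open NaturalTransformation D.ε renaming (at to ε) using ()
    field
      law : NaturalTransformation (M.functor ∘F D.functor) (D.functor ∘F M.functor)
    open NaturalTransformation law public renaming (at to lawAt; commute to law-commute)
    field
      law-η : ∀ X → lawAt X ∘ η (D₀ X) ≈ D₁ (η X)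
      law-ε : ∀ X → ε (M₀ X) ∘ lawAt X ≈ M₁ (ε X)

  module _ (products : BinaryProducts 𝒜) where
    open BinaryProducts products

    infixr 7 _×F_
    _×F_ : Endofunctor 𝒜 → Endofunctor 𝒜 → Endofunctor 𝒜
    F ×F G = record
      { F₀           = λ X → F.F₀ X ⊗ G.F₀ X
      ; F₁           = λ f → F.F₁ f ⊗₁ G.F₁ f
      ; F-resp-≈     = λ p → unique
          (Equiv.trans project₀ (∘-resp-≈ˡ (Equiv.sym (F.F-resp-≈ p))))
          (Equiv.trans project₁ (∘-resp-≈ˡ (Equiv.sym (G.F-resp-≈ p))))
      ; identity     = unique
          (Equiv.trans identityʳ (Equiv.sym (Equiv.trans (∘-resp-≈ˡ F.identity) identityˡ)))
          (Equiv.trans identityʳ (Equiv.sym (Equiv.trans (∘-resp-≈ˡ G.identity) identityˡ)))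
      ; homomorphism = unique
          (comp project₀ project₀ F.homomorphism)
          (comp project₁ project₁ G.homomorphism)
      }
      where
        module F = Functor F
        module G = Functor G
        comp : ∀ {X Y Z X′ Y′ Z′} {p : X ⇒ X′} {q : Y ⇒ Y′} {r : Z ⇒ Z′}
                 {f : X ⇒ Y} {g : Y ⇒ Z} {f′ : X′ ⇒ Y′} {g′ : Y′ ⇒ Z′} {h′ : X′ ⇒ Z′} →
               r ∘ g ≈ g′ ∘ q → q ∘ f ≈ f′ ∘ p → h′ ≈ g′ ∘ f′ → r ∘ (g ∘ f) ≈ h′ ∘ p
        comp {p = p} {q} {r} {f} {g} {f′} {g′} {h′} s t u = begin
          r ∘ (g ∘ f)    ≈⟨ assoc ⟨
          (r ∘ g) ∘ f    ≈⟨ ∘-resp-≈ˡ s ⟩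
          (g′ ∘ q) ∘ f   ≈⟨ assoc ⟩
          g′ ∘ (q ∘ f)   ≈⟨ ∘-resp-≈ʳ t ⟩
          g′ ∘ (f′ ∘ p)  ≈⟨ assoc ⟨
          (g′ ∘ f′) ∘ p  ≈⟨ ∘-resp-≈ˡ u ⟨
          h′ ∘ p         ∎
          where open HomReasoning

    -- the copointed functor (H × Id , π₁)
    cofree : Endofunctor 𝒜 → CopointedFunctor 𝒜
    cofree H = record
      { functor = H ×F idF
      ; ε       = record { at = λ _ → π₁ ; commute = λ _ → project₁ }
      }

    module _ {H : Endofunctor 𝒜} (T : TerminalCoalgebra H)
             {M : PointedFunctor 𝒜} (Λ : DistributiveLaw M (cofree H)) where
      open TerminalCoalgebra T
      open Functor H renaming (F₀ to H₀; F₁ to H₁) using ()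
      open Functor (PointedFunctor.functor M) renaming (F₀ to M₀; F₁ to M₁) using ()
      open DistributiveLaw Λ

      IsInterpretation : M₀ C ⇒ C → Set e
      IsInterpretation b = c ∘ b ≈ H₁ b ∘ π₀ ∘ lawAt C ∘ M₁ ⟨ c , id ⟩

      interpretation-exists-unique : ∃! _≈_ IsInterpretation
      interpretation-exists-unique =
        terminal (record { Carrier = M₀ C ; str = π₀ ∘ lawAt C ∘ M₁ ⟨ c , id ⟩ })

  module _ (coproducts : BinaryCoproducts 𝒜) (G : Endofunctor 𝒜) where
    open BinaryCoproducts coproducts
    open Functor G renaming (F₀ to G₀; F₁ to G₁) using ()

    IsSolution : ∀ {A X} (a : G₀ A ⇒ A) (f : X ⇒ G₀ X ⊕ A) → X ⇒ A → Set e
    IsSolution a f s = s ≈ [ a , id ] ∘ (G₁ s ⊕₁ id) ∘ f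

    IsCompletelyIterative : ∀ {A} → G₀ A ⇒ A → Set (o ⊔ ℓ ⊔ e)
    IsCompletelyIterative {A} a = ∀ {X} (f : X ⇒ G₀ X ⊕ A) → ∃! _≈_ (IsSolution a f)

{-# OPTIONS --safe #-}
-- For φ : Y → HMY put φ₀ = φ and φₙ₊₁ = π₀ · λ · M⟨φₙ , η⟩ : Mⁿ⁺¹Y → HMⁿ⁺²Y.  These maps make
-- ∐ₙ MⁿY an H-coalgebra, so there is exactly one family hₙ : MⁿY → C with c · hₙ = Hhₙ₊₁ · φₙ.
-- By the same uniqueness hₙ = hₙ₊₁ · η, and then hₙ₊₁ = b · Mhₙ; hence h₀ is the unique s with
-- c · s = H(b · Ms) · φ.  An equation morphism f : X → HMX + C is turned into such a φ on
-- Y = X + C by letting the summand C evolve by c followed by η; since b · η = id, the solution is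
-- the identity on that summand.
module Submission where

open import Level using (Level; Lift; lift; lower; _⊔_)
open import Data.Nat.Base using (ℕ; zero; suc)
open import Data.Product using (_,_; ∃-syntax; ∃!; proj₁; proj₂)
open import Data.Unit.Base using (⊤; tt)
open import Relation.Binary.PropositionalEquality.Core using (_≡_; refl; sym; trans)
open import Defs

private
  variable
    o ℓ e o′ ℓ′ e′ : Level

-- Rewriting inside composites.

module CategoryLemmas (𝒜 : Category o ℓ e) where
  open Category 𝒜

  pullˡ : ∀ {A B C D} {f : A ⇒ B} {g : B ⇒ C} {h : C ⇒ D} {k : B ⇒ D} →
          h ∘ g ≈ k → h ∘ g ∘ f ≈ k ∘ f
  pullˡ p = Equiv.trans (Equiv.sym assoc) (∘-resp-≈ˡ p)

  pullʳ : ∀ {A B C D} {f : A ⇒ B} {g : B ⇒ C} {h : C ⇒ D} {k : A ⇒ C} →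
          g ∘ f ≈ k → (h ∘ g) ∘ f ≈ h ∘ k
  pullʳ p = Equiv.trans assoc (∘-resp-≈ʳ p)

  cancelˡ : ∀ {A B C} {f : A ⇒ B} {g : B ⇒ C} {h : C ⇒ B} →
            h ∘ g ≈ id → h ∘ g ∘ f ≈ f
  cancelˡ p = Equiv.trans (pullˡ p) identityˡ

-- Countable coproducts as colimits of discrete diagrams.

module CountableCoproducts (𝒜 : Category o ℓ e) where
  open Category 𝒜

  record CountableCoproduct (F : ℕ → Obj) : Set (o ⊔ ℓ ⊔ e) where
    field
      ∐         : Obj
      ι         : ∀ n → F n ⇒ ∐
      universal : ∀ {K} (f : ∀ n → F n ⇒ K) → ∃! _≈_ λ (u : ∐ ⇒ K) → ∀ n → u ∘ ι n ≈ f n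

    copair : ∀ {K} → (∀ n → F n ⇒ K) → ∐ ⇒ K
    copair f = proj₁ (universal f)

    copair-ι : ∀ {K} (f : ∀ n → F n ⇒ K) n → copair f ∘ ι n ≈ f n
    copair-ι f = proj₁ (proj₂ (universal f))

    ι-jointly-epic : ∀ {K} {u v : ∐ ⇒ K} → (∀ n → u ∘ ι n ≈ v ∘ ι n) → u ≈ v
    ι-jointly-epic {v = v} p =
      let _ , _ , uniq = universal (λ n → v ∘ ι n)
      in Equiv.trans (Equiv.sym (uniq p)) (uniq (λ _ → Equiv.refl))

  -- Lifted to arbitrary levels because `Cocomplete` fixes the levels of its shapes. Parallel
  -- morphisms are all identified, so a functor out of this category must not depend on the choice
  -- of equality proof.
  discreteℕ : ∀ o′ ℓ′ e′ → Category o′ ℓ′ e′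
  discreteℕ o′ ℓ′ e′ = record
    { Obj       = Lift o′ ℕ
    ; _⇒_       = λ m n → Lift ℓ′ (lower m ≡ lower n)
    ; _≈_       = λ _ _ → Lift e′ ⊤
    ; id        = lift refl
    ; _∘_       = λ q p → lift (trans (lower p) (lower q))
    ; equiv     = record { refl = lift tt ; sym = λ _ → lift tt ; trans = λ _ _ → lift tt }
    ; ∘-resp-≈  = λ _ _ → lift tt
    ; assoc     = lift tt
    ; identityˡ = lift tt
    ; identityʳ = lift tt
    }

  discreteDiagram : (ℕ → Obj) → Functor (discreteℕ o′ ℓ′ e′) 𝒜
  discreteDiagram F = record
    { F₀           = λ n → F (lower n)
    ; F₁           = λ p → transport (lower p)
    ; F-resp-≈     = λ {_} {_} {p} {q} _ → transport-irrelevant (lower p) (lower q)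
    ; identity     = Equiv.refl
    ; homomorphism = λ {_} {_} {_} {p} {q} → transport-trans (lower p) (lower q)
    }
    where
      transport : ∀ {m n} → m ≡ n → F m ⇒ F n
      transport refl = id

      -- Matching both proofs with `refl` is uniqueness of identity proofs on `ℕ`.
      transport-irrelevant : ∀ {m n} (p q : m ≡ n) → transport p ≈ transport q
      transport-irrelevant refl refl = Equiv.refl

      transport-trans : ∀ {m n k} (p : m ≡ n) (q : n ≡ k) →
                        transport (trans p q) ≈ transport q ∘ transport p
      transport-trans refl refl = Equiv.sym identityˡ

  countableCoproduct : Cocomplete o′ ℓ′ e′ 𝒜 → (F : ℕ → Obj) → CountableCoproduct F
  countableCoproduct cocomplete F = record
    { ∐         = apex
    ; ι         = λ n → leg (lift n)
    ; universal = λ f →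
        let u , commutes , uniq = colimit.universal (toCocone f)
        in u , (λ n → commutes (lift n)) , λ p → uniq (λ j → p (lower j))
    }
    where
      diagram = discreteDiagram F
      module colimit = Colimit (cocomplete _ diagram)
      open Cocone colimit.cocone

      toCocone : ∀ {K} → (∀ n → F n ⇒ K) → Cocone diagram
      toCocone f = record
        { apex    = _
        ; leg     = λ j → f (lower j)
        ; commute = λ { (lift refl) → identityʳ }
        }

-- Corecursive sequences of maps into a terminal coalgebra.

module CorecursiveSequences
    {𝒜 : Category o ℓ e} {H : Endofunctor 𝒜} (T : TerminalCoalgebra H)
    (coproduct : ∀ F → CountableCoproducts.CountableCoproduct 𝒜 F) where
  open Category 𝒜
  open HomReasoning
  open CategoryLemmas 𝒜
  open CountableCoproducts 𝒜
  open TerminalCoalgebra T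
  open Functor H renaming (F₀ to H₀; F₁ to H₁; homomorphism to H-∘; F-resp-≈ to H-cong) using ()

  module _ {F : ℕ → Obj} (φ : ∀ n → F n ⇒ H₀ (F (suc n))) where
    open CountableCoproduct (coproduct F)

    -- `F` and `φ` stay arbitrary, instead of being iterates of `M`, so that uniqueness also applies
    -- to a sequence with its first term dropped.
    Solves : (∀ n → F n ⇒ C) → Set e
    Solves h = ∀ n → c ∘ h n ≈ H₁ (h (suc n)) ∘ φ n

    total : Coalgebra H
    total = record { Carrier = ∐ ; str = copair (λ n → H₁ (ι (suc n)) ∘ φ n) }

    str-ι : ∀ {u : ∐ ⇒ C} n →
            (H₁ u ∘ Coalgebra.str total) ∘ ι n ≈ H₁ (u ∘ ι (suc n)) ∘ φ n
    str-ι {u} n = begin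
      (H₁ u ∘ Coalgebra.str total) ∘ ι n  ≈⟨ pullʳ (copair-ι _ n) ⟩
      H₁ u ∘ H₁ (ι (suc n)) ∘ φ n         ≈⟨ pullˡ (Equiv.sym H-∘) ⟩
      H₁ (u ∘ ι (suc n)) ∘ φ n            ∎

    -- Restricted along `ι n`, the homomorphism equation becomes the `n`-th equation of `Solves`.
    solves⇒hom : ∀ {h} → Solves h → IsCoalgebraHom total coalgebra (copair h)
    solves⇒hom {h} solves = ι-jointly-epic λ n → begin
      (c ∘ copair h) ∘ ι n                       ≈⟨ pullʳ (copair-ι h n) ⟩
      c ∘ h n                                    ≈⟨ solves n ⟩
      H₁ (h (suc n)) ∘ φ n                       ≈⟨ ∘-resp-≈ˡ (H-cong (copair-ι h (suc n))) ⟨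
      H₁ (copair h ∘ ι (suc n)) ∘ φ n            ≈⟨ str-ι n ⟨
      (H₁ (copair h) ∘ Coalgebra.str total) ∘ ι n ∎

    solution-exists : ∃[ h ] Solves h
    solution-exists with u , hom , _ ← terminal total =
      (λ n → u ∘ ι n) , λ n → begin
        c ∘ u ∘ ι n                         ≈⟨ pullˡ hom ⟩
        (H₁ u ∘ Coalgebra.str total) ∘ ι n  ≈⟨ str-ι n ⟩
        H₁ (u ∘ ι (suc n)) ∘ φ n            ∎

    solution-unique : ∀ {h k} → Solves h → Solves k → ∀ n → h n ≈ k n
    solution-unique {h} {k} p q n with _ , _ , uniq ← terminal total = begin
      h n             ≈⟨ copair-ι h n ⟨
      copair h ∘ ι n  ≈⟨ ∘-resp-≈ˡ (Equiv.trans (Equiv.sym (uniq (solves⇒hom p))) (uniq (solves⇒hom q))) ⟩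
      copair k ∘ ι n  ≈⟨ copair-ι k n ⟩
      k n             ∎

-- The one-step extension along the law, and the λ-interpretation.

module Interpretation
    {𝒜 : Category o ℓ e} (products : BinaryProducts 𝒜)
    {H : Endofunctor 𝒜} (T : TerminalCoalgebra H)
    {M : PointedFunctor 𝒜} (Λ : DistributiveLaw M (cofree products H)) where
  open Category 𝒜
  open HomReasoning
  open CategoryLemmas 𝒜
  open BinaryProducts products
  open TerminalCoalgebra T
  open DistributiveLaw Λ
  open Functor H public
    renaming (F₀ to H₀; F₁ to H₁; homomorphism to H-∘; F-resp-≈ to H-cong; identity to H-id) using ()
  open Functor (PointedFunctor.functor M) public
    renaming (F₀ to M₀; F₁ to M₁; homomorphism to M-∘; F-resp-≈ to M-cong) using ()
  open NaturalTransformation (PointedFunctor.η M) public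
    renaming (at to η; commute to η-commute)

  ⟨⟩-cong : ∀ {X A B} {f f′ : X ⇒ A} {g g′ : X ⇒ B} → f ≈ f′ → g ≈ g′ → ⟨ f , g ⟩ ≈ ⟨ f′ , g′ ⟩
  ⟨⟩-cong p q = unique (Equiv.trans project₀ (Equiv.sym p)) (Equiv.trans project₁ (Equiv.sym q))

  ⟨⟩-∘ : ∀ {W X A B} {f : X ⇒ A} {g : X ⇒ B} {h : W ⇒ X} → ⟨ f , g ⟩ ∘ h ≈ ⟨ f ∘ h , g ∘ h ⟩
  ⟨⟩-∘ = Equiv.sym (unique (pullˡ project₀) (pullˡ project₁))

  ⊗₁-⟨⟩ : ∀ {X A B A′ B′} {f : A ⇒ A′} {g : B ⇒ B′} {p : X ⇒ A} {q : X ⇒ B} →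
          (f ⊗₁ g) ∘ ⟨ p , q ⟩ ≈ ⟨ f ∘ p , g ∘ q ⟩
  ⊗₁-⟨⟩ = Equiv.trans ⟨⟩-∘ (⟨⟩-cong (pullʳ project₀) (pullʳ project₁))

  H-id-c : {u : C ⇒ C} → u ≈ id → H₁ u ∘ c ≈ c
  H-id-c p = Equiv.trans (∘-resp-≈ˡ (Equiv.trans (H-cong p) H-id)) identityˡ

  -- Finality, with `id` as the competing endomorphism.
  endo-hom≈id : ∀ {u} → IsCoalgebraHom coalgebra coalgebra u → u ≈ id
  endo-hom≈id p with _ , _ , uniq ← terminal coalgebra =
    Equiv.trans (Equiv.sym (uniq p)) (uniq (Equiv.trans identityʳ (Equiv.sym (H-id-c Equiv.refl))))

  -- For `p = c` and `q = id` this is the coalgebra on `M₀ C` whose unique homomorphism to `C` is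
  -- the interpretation. Source and target differ so that each term of a sequence can be built from
  -- the preceding one.
  extend : ∀ {Y Z} → Y ⇒ H₀ Z → Y ⇒ Z → M₀ Y ⇒ H₀ (M₀ Z)
  extend {Z = Z} p q = π₀ ∘ lawAt Z ∘ M₁ ⟨ p , q ⟩

  extend-cong : ∀ {Y Z} {p p′ : Y ⇒ H₀ Z} {q q′ : Y ⇒ Z} → p ≈ p′ → q ≈ q′ →
                extend p q ≈ extend p′ q′
  extend-cong r s = ∘-resp-≈ʳ (∘-resp-≈ʳ (M-cong (⟨⟩-cong r s)))

  extend-M₁ : ∀ {X Y Z} {p : Y ⇒ H₀ Z} {q : Y ⇒ Z} {f : X ⇒ Y} →
              extend p q ∘ M₁ f ≈ extend (p ∘ f) (q ∘ f)
  extend-M₁ = pullʳ (pullʳ (Equiv.trans (Equiv.sym M-∘) (M-cong ⟨⟩-∘)))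

  -- Naturality of the law at `f`, read off in the `H`-component.
  extend-natural : ∀ {Y Z W} {p : Y ⇒ H₀ Z} {q : Y ⇒ Z} {f : Z ⇒ W} →
                   extend (H₁ f ∘ p) (f ∘ q) ≈ H₁ (M₁ f) ∘ extend p q
  extend-natural {Z = Z} {W} {p} {q} {f} = begin
    π₀ ∘ lawAt W ∘ M₁ ⟨ H₁ f ∘ p , f ∘ q ⟩             ≈⟨ ∘-resp-≈ʳ (∘-resp-≈ʳ (M-cong ⊗₁-⟨⟩)) ⟨
    π₀ ∘ lawAt W ∘ M₁ ((H₁ f ⊗₁ f) ∘ ⟨ p , q ⟩)        ≈⟨ ∘-resp-≈ʳ (∘-resp-≈ʳ M-∘) ⟩
    π₀ ∘ lawAt W ∘ M₁ (H₁ f ⊗₁ f) ∘ M₁ ⟨ p , q ⟩       ≈⟨ ∘-resp-≈ʳ (pullˡ (law-commute f)) ⟩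
    π₀ ∘ ((H₁ (M₁ f) ⊗₁ M₁ f) ∘ lawAt Z) ∘ M₁ ⟨ p , q ⟩ ≈⟨ ∘-resp-≈ʳ assoc ⟩
    π₀ ∘ (H₁ (M₁ f) ⊗₁ M₁ f) ∘ lawAt Z ∘ M₁ ⟨ p , q ⟩  ≈⟨ pullˡ project₀ ⟩
    (H₁ (M₁ f) ∘ π₀) ∘ lawAt Z ∘ M₁ ⟨ p , q ⟩          ≈⟨ assoc ⟩
    H₁ (M₁ f) ∘ extend p q                             ∎

  -- Naturality moves `η` next to the law, where `law-η` absorbs it; `π₀` then discards `q`.
  extend-η : ∀ {Y Z} {p : Y ⇒ H₀ Z} {q : Y ⇒ Z} → extend p q ∘ η Y ≈ H₁ (η Z) ∘ p
  extend-η {Y} {Z} {p} {q} = begin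
    (π₀ ∘ lawAt Z ∘ M₁ ⟨ p , q ⟩) ∘ η Y    ≈⟨ pullʳ (pullʳ (Equiv.sym (η-commute ⟨ p , q ⟩))) ⟩
    π₀ ∘ lawAt Z ∘ η _ ∘ ⟨ p , q ⟩         ≈⟨ pullʳ assoc ⟨
    (π₀ ∘ lawAt Z ∘ η _) ∘ ⟨ p , q ⟩       ≈⟨ ∘-resp-≈ˡ (∘-resp-≈ʳ (law-η Z)) ⟩
    (π₀ ∘ (H₁ (η Z) ⊗₁ η Z)) ∘ ⟨ p , q ⟩   ≈⟨ ∘-resp-≈ˡ project₀ ⟩
    (H₁ (η Z) ∘ π₀) ∘ ⟨ p , q ⟩            ≈⟨ pullʳ project₀ ⟩
    H₁ (η Z) ∘ p                           ∎

  module _ {b : M₀ C ⇒ C} (interprets : IsInterpretation products T Λ b) where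

    -- By `extend-η`, the composite is a coalgebra endomorphism of `C`.
    b-η : b ∘ η C ≈ id
    b-η = endo-hom≈id (begin
      c ∘ b ∘ η C                  ≈⟨ pullˡ interprets ⟩
      (H₁ b ∘ extend c id) ∘ η C   ≈⟨ pullʳ extend-η ⟩
      H₁ b ∘ H₁ (η C) ∘ c          ≈⟨ pullˡ (Equiv.sym H-∘) ⟩
      H₁ (b ∘ η C) ∘ c             ∎)

    b-M₁-η : ∀ {Y} {f : Y ⇒ C} → (b ∘ M₁ f) ∘ η Y ≈ f
    b-M₁-η {f = f} = Equiv.trans (pullʳ (Equiv.sym (η-commute f))) (cancelˡ b-η)

    -- The two hypotheses together factor `⟨ c ∘ f , f ⟩` as `H₁ g ⊗₁ g` after `⟨ p , q ⟩`, so
    -- naturality of the law can pull `M₁ g` out. This carries a corecursive equation through one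
    -- application of `M`.
    b-extend : ∀ {Y Z} {p : Y ⇒ H₀ Z} {q : Y ⇒ Z} {f : Y ⇒ C} {g : Z ⇒ C} →
               c ∘ f ≈ H₁ g ∘ p → f ≈ g ∘ q →
               c ∘ b ∘ M₁ f ≈ H₁ (b ∘ M₁ g) ∘ extend p q
    b-extend {p = p} {q} {f} {g} r s = begin
      c ∘ b ∘ M₁ f                       ≈⟨ pullˡ interprets ⟩
      (H₁ b ∘ extend c id) ∘ M₁ f        ≈⟨ pullʳ extend-M₁ ⟩
      H₁ b ∘ extend (c ∘ f) (id ∘ f)     ≈⟨ ∘-resp-≈ʳ (extend-cong r (Equiv.trans identityˡ s)) ⟩
      H₁ b ∘ extend (H₁ g ∘ p) (g ∘ q)   ≈⟨ ∘-resp-≈ʳ extend-natural ⟩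
      H₁ b ∘ H₁ (M₁ g) ∘ extend p q      ≈⟨ pullˡ (Equiv.sym H-∘) ⟩
      H₁ (b ∘ M₁ g) ∘ extend p q         ∎

    -- λ-coinduction by iterating `M`.

    module Coinduction
        (coproduct : ∀ F → CountableCoproducts.CountableCoproduct 𝒜 F)
        {Y : Obj} (φ : Y ⇒ H₀ (M₀ Y)) where
      open CorecursiveSequences T coproduct

      M^ : ℕ → Obj
      M^ zero    = Y
      M^ (suc n) = M₀ (M^ n)

      φ^ : ∀ n → M^ n ⇒ H₀ (M^ (suc n))
      φ^ zero    = φ
      φ^ (suc n) = extend (φ^ n) (η (M^ n))

      φ^-η : ∀ n → φ^ (suc n) ∘ η (M^ n) ≈ H₁ (η (M^ (suc n))) ∘ φ^ n
      φ^-η n = extend-η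

      LambdaSolves : Y ⇒ C → Set e
      LambdaSolves s = c ∘ s ≈ H₁ (b ∘ M₁ s) ∘ φ

      module _ {h : ∀ n → M^ n ⇒ C} (solves : Solves φ^ h) where

        -- By `φ^-η`, `η` commutes with the steps of `φ^`, so the right-hand family solves `φ^` too.
        h-η : ∀ n → h n ≈ h (suc n) ∘ η (M^ n)
        h-η = solution-unique φ^ solves λ n → begin
          c ∘ h (suc n) ∘ η (M^ n)                              ≈⟨ pullˡ (solves (suc n)) ⟩
          (H₁ (h (suc (suc n))) ∘ φ^ (suc n)) ∘ η (M^ n)        ≈⟨ pullʳ (φ^-η n) ⟩
          H₁ (h (suc (suc n))) ∘ H₁ (η (M^ (suc n))) ∘ φ^ n     ≈⟨ pullˡ (Equiv.sym H-∘) ⟩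
          H₁ (h (suc (suc n)) ∘ η (M^ (suc n))) ∘ φ^ n          ∎

        -- Both sides solve the sequence that starts at `φ^ 1`; for the right-hand side, `h-η` is
        -- the factorisation that `b-extend` asks for.
        h-suc : ∀ n → h (suc n) ≈ b ∘ M₁ (h n)
        h-suc = solution-unique (λ n → φ^ (suc n)) (λ n → solves (suc n))
                  (λ n → b-extend (solves n) (h-η n))

      -- Turns a single λ-solution back into a whole family, so that uniqueness of families yields
      -- uniqueness of `s`.
      iterate : Y ⇒ C → ∀ n → M^ n ⇒ C
      iterate s zero    = s
      iterate s (suc n) = b ∘ M₁ (iterate s n)

      iterate-solves : ∀ {s} → LambdaSolves s → Solves φ^ (iterate s)
      iterate-solves solves zero    = solves
      -- Here the factorisation through `η` needs no induction: `b-M₁-η` holds for every map into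
      -- `C`.
      iterate-solves solves (suc n) = b-extend (iterate-solves solves n) (Equiv.sym b-M₁-η)

      lambda-coinduction : ∃! _≈_ LambdaSolves
      lambda-coinduction with h , solves ← solution-exists φ^ =
        h zero ,
        Equiv.trans (solves zero) (∘-resp-≈ˡ (H-cong (h-suc solves zero))) ,
        λ p → solution-unique φ^ solves (iterate-solves p) zero

-- Equation morphisms and their solutions.

module CompletelyIterative
    {𝒜 : Category o ℓ e} (products : BinaryProducts 𝒜) (coproducts : BinaryCoproducts 𝒜)
    {H : Endofunctor 𝒜} (T : TerminalCoalgebra H)
    (coproduct : ∀ F → CountableCoproducts.CountableCoproduct 𝒜 F)
    {M : PointedFunctor 𝒜} (Λ : DistributiveLaw M (cofree products H)) where
  open Category 𝒜
  open HomReasoning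
  open CategoryLemmas 𝒜
  open BinaryCoproducts coproducts
  open TerminalCoalgebra T
  open Interpretation products T Λ

  i-jointly-epic : ∀ {A B X} {u v : A ⊕ B ⇒ X} → u ∘ i₀ ≈ v ∘ i₀ → u ∘ i₁ ≈ v ∘ i₁ → u ≈ v
  i-jointly-epic p q = Equiv.trans (Equiv.sym (unique p q)) (unique Equiv.refl Equiv.refl)

  module _ {b : M₀ C ⇒ C} (interprets : IsInterpretation products T Λ b)
           {X : Obj} (f : X ⇒ H₀ (M₀ X) ⊕ C) where

    a : H₀ (M₀ C) ⇒ C
    a = c⁻¹ ∘ H₁ b

    -- The solution equation with `f` split off, so that it can be compared with `step` on each
    -- summand.
    rhs : X ⇒ C → H₀ (M₀ X) ⊕ C ⇒ C
    rhs s = [ a , id ] ∘ (H₁ (M₁ s) ⊕₁ id)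

    evolve : C ⇒ H₀ (M₀ (X ⊕ C))
    evolve = H₁ (η (X ⊕ C)) ∘ H₁ i₁ ∘ c

    step : H₀ (M₀ X) ⊕ C ⇒ H₀ (M₀ (X ⊕ C))
    step = [ H₁ (M₁ i₀) , evolve ]

    -- `evolve` enters twice: through `step` for parameters that `f` returns, and directly for
    -- states already in `C`.
    φ : X ⊕ C ⇒ H₀ (M₀ (X ⊕ C))
    φ = [ step ∘ f , evolve ]

    open Coinduction interprets coproduct φ using (LambdaSolves; lambda-coinduction)

    -- The `η` inside `evolve` cancels the layer `b ∘ M₁ t` down to `t`.
    evolve-interpreted : (t : X ⊕ C ⇒ C) → H₁ (b ∘ M₁ t) ∘ evolve ≈ H₁ (t ∘ i₁) ∘ c
    evolve-interpreted t = begin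
      H₁ (b ∘ M₁ t) ∘ H₁ (η (X ⊕ C)) ∘ H₁ i₁ ∘ c  ≈⟨ pullˡ (Equiv.sym H-∘) ⟩
      H₁ ((b ∘ M₁ t) ∘ η (X ⊕ C)) ∘ H₁ i₁ ∘ c     ≈⟨ ∘-resp-≈ˡ (H-cong (b-M₁-η interprets)) ⟩
      H₁ t ∘ H₁ i₁ ∘ c                            ≈⟨ pullˡ (Equiv.sym H-∘) ⟩
      H₁ (t ∘ i₁) ∘ c                             ∎

    step-interpreted : ∀ {t s} → t ∘ i₀ ≈ s → t ∘ i₁ ≈ id → H₁ (b ∘ M₁ t) ∘ step ≈ c ∘ rhs s
    step-interpreted {t} {s} p q = i-jointly-epic
      (begin
        (H₁ (b ∘ M₁ t) ∘ step) ∘ i₀         ≈⟨ pullʳ inject₀ ⟩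
        H₁ (b ∘ M₁ t) ∘ H₁ (M₁ i₀)          ≈⟨ H-∘ ⟨
        H₁ ((b ∘ M₁ t) ∘ M₁ i₀)             ≈⟨ H-cong (pullʳ (Equiv.trans (Equiv.sym M-∘) (M-cong p))) ⟩
        H₁ (b ∘ M₁ s)                       ≈⟨ H-∘ ⟩
        -- Inserting `c ∘ c⁻¹` makes the algebra structure `a` appear.
        H₁ b ∘ H₁ (M₁ s)                    ≈⟨ cancelˡ Lambek.isoʳ ⟨
        c ∘ c⁻¹ ∘ H₁ b ∘ H₁ (M₁ s)          ≈⟨ ∘-resp-≈ʳ assoc ⟨
        c ∘ a ∘ H₁ (M₁ s)                   ≈⟨ ∘-resp-≈ʳ (pullˡ inject₀) ⟨
        c ∘ [ a , id ] ∘ i₀ ∘ H₁ (M₁ s)     ≈⟨ pullʳ (pullʳ inject₀) ⟨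
        (c ∘ rhs s) ∘ i₀                    ∎)
      (begin
        (H₁ (b ∘ M₁ t) ∘ step) ∘ i₁         ≈⟨ pullʳ inject₁ ⟩
        H₁ (b ∘ M₁ t) ∘ evolve              ≈⟨ evolve-interpreted t ⟩
        H₁ (t ∘ i₁) ∘ c                     ≈⟨ H-id-c q ⟩
        c                                   ≈⟨ identityʳ ⟨
        c ∘ id                              ≈⟨ ∘-resp-≈ʳ (Equiv.trans (pullˡ inject₁) identityˡ) ⟨
        c ∘ [ a , id ] ∘ i₁ ∘ id            ≈⟨ pullʳ (pullʳ inject₁) ⟨
        (c ∘ rhs s) ∘ i₁                    ∎)

    Solution : X ⇒ C → Set e
    Solution = IsSolution coproducts (H ∘F PointedFunctor.functor M) a f

    solution⇒λ-solution : ∀ {s} → Solution s → LambdaSolves [ s , id ]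
    solution⇒λ-solution {s} p = i-jointly-epic
      (begin
        (c ∘ [ s , id ]) ∘ i₀                     ≈⟨ pullʳ inject₀ ⟩
        c ∘ s                                     ≈⟨ ∘-resp-≈ʳ (Equiv.trans p (Equiv.sym assoc)) ⟩
        c ∘ rhs s ∘ f                             ≈⟨ pullˡ (Equiv.sym (step-interpreted inject₀ inject₁)) ⟩
        (H₁ (b ∘ M₁ [ s , id ]) ∘ step) ∘ f       ≈⟨ assoc ⟩
        H₁ (b ∘ M₁ [ s , id ]) ∘ step ∘ f         ≈⟨ pullʳ inject₀ ⟨
        (H₁ (b ∘ M₁ [ s , id ]) ∘ φ) ∘ i₀         ∎)
      (begin
        (c ∘ [ s , id ]) ∘ i₁                     ≈⟨ pullʳ inject₁ ⟩
        c ∘ id                                    ≈⟨ identityʳ ⟩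
        c                                         ≈⟨ H-id-c inject₁ ⟨
        H₁ ([ s , id ] ∘ i₁) ∘ c                  ≈⟨ evolve-interpreted [ s , id ] ⟨
        H₁ (b ∘ M₁ [ s , id ]) ∘ evolve           ≈⟨ pullʳ inject₁ ⟨
        (H₁ (b ∘ M₁ [ s , id ]) ∘ φ) ∘ i₁         ∎)

    -- On the summand `C` the equation is that of a coalgebra endomorphism. Hence a λ-solution
    -- carries no information beyond its restriction to `X`.
    λ-solution-i₁ : ∀ {t} → LambdaSolves t → t ∘ i₁ ≈ id
    λ-solution-i₁ {t} p = endo-hom≈id (begin
      c ∘ t ∘ i₁                ≈⟨ pullˡ p ⟩
      (H₁ (b ∘ M₁ t) ∘ φ) ∘ i₁  ≈⟨ pullʳ inject₁ ⟩
      H₁ (b ∘ M₁ t) ∘ evolve    ≈⟨ evolve-interpreted t ⟩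
      H₁ (t ∘ i₁) ∘ c           ∎)

    -- The λ-equation only describes `c ∘ t`, so `c⁻¹ ∘ c` is inserted to apply it and removed
    -- afterwards.
    λ-solution⇒solution : ∀ {t} → LambdaSolves t → Solution (t ∘ i₀)
    λ-solution⇒solution {t} p = begin
      t ∘ i₀                              ≈⟨ cancelˡ Lambek.isoˡ ⟨
      c⁻¹ ∘ c ∘ t ∘ i₀                    ≈⟨ ∘-resp-≈ʳ (pullˡ p) ⟩
      c⁻¹ ∘ (H₁ (b ∘ M₁ t) ∘ φ) ∘ i₀      ≈⟨ ∘-resp-≈ʳ (pullʳ inject₀) ⟩
      c⁻¹ ∘ H₁ (b ∘ M₁ t) ∘ step ∘ f      ≈⟨ ∘-resp-≈ʳ (pullˡ (step-interpreted Equiv.refl (λ-solution-i₁ p))) ⟩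
      c⁻¹ ∘ (c ∘ rhs (t ∘ i₀)) ∘ f        ≈⟨ ∘-resp-≈ʳ assoc ⟩
      c⁻¹ ∘ c ∘ rhs (t ∘ i₀) ∘ f          ≈⟨ cancelˡ Lambek.isoˡ ⟩
      rhs (t ∘ i₀) ∘ f                    ≈⟨ assoc ⟩
      [ a , id ] ∘ (H₁ (M₁ (t ∘ i₀)) ⊕₁ id) ∘ f ∎

    solution : ∃! _≈_ Solution
    solution with t , solves , uniq ← lambda-coinduction =
      t ∘ i₀ ,
      λ-solution⇒solution solves ,
      -- Any solution `s` extends to the λ-solution `[ s , id ]`, which must equal `t`; restriction
      -- along `i₀` recovers `s`.
      λ p → Equiv.trans (∘-resp-≈ˡ (uniq (solution⇒λ-solution p))) inject₀

mainTheorem18 :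
    ∀ {o ℓ e o′ ℓ′ e′ : Level} (𝒜 : Category o ℓ e)
      (products : BinaryProducts 𝒜) (coproducts : BinaryCoproducts 𝒜)
      (H : Endofunctor 𝒜) (T : TerminalCoalgebra H) →
    Cocomplete o′ ℓ′ e′ 𝒜 →
    ∀ (M : PointedFunctor 𝒜) (Λ : DistributiveLaw M (cofree products H)) →
    let open Category 𝒜
        open TerminalCoalgebra T
        module H = Functor H
        MF = PointedFunctor.functor M
        module M = Functor MF
    in
    ∀ (b : M.F₀ C ⇒ C) → IsInterpretation products T Λ b →
    IsCompletelyIterative coproducts (H ∘F MF) (c⁻¹ ∘ H.F₁ b)
mainTheorem18 𝒜 products coproducts H T cocomplete M Λ b interprets f =
  CompletelyIterative.solution products coproducts T
    (CountableCoproducts.countableCoproduct 𝒜 cocomplete) Λ interprets f
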